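{- Let $\Pi$ and $\Pi'$ be polar spaces of ranks $n$ and $n'$ respectively, with $n\le n'$, and let $f:{\mathcal G}_{n-1}(\Pi)\to {\mathcal G}_{n'-1}(\Pi')$ be an isometric embedding of $\Gamma_{n-1}(\Pi)$ in $\Gamma_{n'-1}(\Pi')$. Then there exists an $(n'-n-1)$-dimensional singular subspace $M$ of $\Pi'$ such that the image of $f$ is contained in $[M\rangle_{n'-1}$ and $f$ is induced by a frames preserving mapping $g$ of $\Pi$ to the polar space $[M\rangle_{n'-n}$, i.e. for every $S\in{\mathcal G}_{n-1}(\Pi)$, $f(S)$ is the maximal singular subspace of $\Pi'$ spanned by the subspaces $g(p)$, $p\in S$.
   Context: A polar space is a partial linear space $\Pi=(P,\mathcal L)$ (points and lines, two distinct collinear points on a unique line) in which every line has at least three points, no point is collinear with all points, each point is collinear with exactly one or all points of any line, and every flag of singular subspaces (subspaces in which any two points are collinear) is finite. Write $p\perp q$ for collinearity. Dimensions of singular subspaces are projective dimensions (empty set: $-1$, point: $0$). The rank $n$ means all maximal singular subspaces are projective spaces of dimension $n-1\ge 2$. ${\mathcal G}_{k}(\Pi)$ is the set of $k$-dimensional singular subspaces of $\Pi$; $\Gamma_{n-1}(\Pi)$ is the graph on ${\mathcal G}_{n-1}(\Pi)$ where two maximal singular subspaces are adjacent iff their intersection is $(n-2)$-dimensional (similarly $\Gamma_{n'-1}(\Pi')$). For a singular subspace $M$ of $\Pi'$ and $k>\dim M$, $[M\rangle_k$ is the set of $k$-dimensional singular subspaces of $\Pi'$ containing $M$. For $M$ of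 dimension $n'-n-1$, $[M\rangle_{n'-n}$ is a polar space of rank $n$ whose points are the elements of $[M\rangle_{n'-n}$ and whose lines are the sets of all elements of $[M\rangle_{n'-n}$ contained in some fixed element of $[M\rangle_{n'-n+1}$ (if $M=\emptyset$, i.e. $n=n'$, this is $\Pi'$ itself). A frame of a rank $n$ polar space is a set of $2n$ points $\{p_1,\dots,p_{2n}\}$ such that for each $i$ there is a unique $\sigma(i)$ with $p_i\not\perp p_{\sigma(i)}$. A frames preserving mapping between polar spaces of the same rank is a map on points sending every frame to a frame. An isometric embedding of graphs is an injection on vertices preserving graph distance. -}

module Defs where

open import Level using (Level; _⊔_; Lift) renaming (suc to lsuc; zero to lzero)
open import Data.Nat using (ℕ; zero; suc; _<_; _≤_; _∸_; _+_; _*_)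
open import Data.Fin using (Fin)
open import Data.Product using (Σ; ∃; _×_; _,_; proj₁; proj₂)
open import Data.Sum using (_⊎_)
open import Relation.Nullary using (¬_)
open import Relation.Binary.PropositionalEquality using (_≡_; _≢_)

_⊆_ : ∀ {a b c} {A : Set a} → (A → Set b) → (A → Set c) → Set (a ⊔ b ⊔ c)
X ⊆ Y = ∀ x → X x → Y x

_≐_ : ∀ {a b c} {A : Set a} → (A → Set b) → (A → Set c) → Set (a ⊔ b ⊔ c)
X ≐ Y = (X ⊆ Y) × (Y ⊆ X)

_∩_ : ∀ {a b c} {A : Set a} → (A → Set b) → (A → Set c) → A → Set (b ⊔ c)
(X ∩ Y) x = X x × Y x

record PolarSpace : Set₁ where
  field
    Point : Set
    Line  : Set
    _I_   : Point → Line → Set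

  _⊥_ : Point → Point → Set
  p ⊥ q = (p ≡ q) ⊎ (Σ Line λ l → (p I l) × (q I l))

  field
    three-points : ∀ l → Σ Point λ a → Σ Point λ b → Σ Point λ c →
                     (a I l) × (b I l) × (c I l) × (a ≢ b) × (a ≢ c) × (b ≢ c)
    unique-line : ∀ {p q l m} → p ≢ q → p I l → q I l → p I m → q I m → l ≡ m
    nondegenerate : ∀ p → Σ Point λ q → ¬ (p ⊥ q)
    one-or-all : ∀ p l →
      (Σ Point λ q → (q I l) × (p ⊥ q) × (∀ r → r I l → p ⊥ r → r ≡ q))
      ⊎ (∀ r → r I l → p ⊥ r)

  IsSubspace : ∀ {b} → (Point → Set b) → Set b
  IsSubspace X = ∀ l p q → p ≢ q → p I l → q I l → X p → X q → ∀ r → r I l → X r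

  Singular : ∀ {b} → (Point → Set b) → Set b
  Singular X = ∀ p q → X p → X q → p ⊥ q

  Span : ∀ {b} → (Point → Set b) → Point → Set (lsuc lzero ⊔ b)
  Span U x = (Y : Point → Set) → IsSubspace Y → U ⊆ Y → Y x

  SingSub : ∀ {b} → (Point → Set b) → Set b
  SingSub X = IsSubspace X × Singular X

  GeneratedBy : ∀ {b} {m} → (Point → Set b) → (Fin m → Point) → Set (lsuc lzero ⊔ b)
  GeneratedBy X v = Span (λ x → Σ _ λ i → v i ≡ x) ≐ X

  -- Dim1 X m : X has projective dimension m - 1, i.e. X is spanned by m
  -- points but not by fewer  (Dim1 X 0 means X = ∅, dimension -1)
  Dim1 : ∀ {b} → (Point → Set b) → ℕ → Set (lsuc lzero ⊔ b)
  Dim1 X m = (Σ (Fin m → Point) λ v → GeneratedBy X v)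
           × (∀ k → k < m → ¬ (Σ (Fin k → Point) λ w → GeneratedBy X w))

  MaxSing : (Point → Set) → Set₁
  MaxSing X = SingSub X × ((Y : Point → Set) → SingSub Y → X ⊆ Y → Y ⊆ X)

  -- 𝒢 m : the (m-1)-dimensional singular subspaces
  𝒢 : ℕ → Set₁
  𝒢 m = Σ (Point → Set) λ X → SingSub X × Dim1 X m

  -- [M⟩ m : the (m-1)-dimensional singular subspaces containing M
  Star : (Point → Set) → ℕ → Set₁
  Star M m = Σ (Point → Set) λ A → SingSub A × Dim1 A m × (M ⊆ A)

open PolarSpace public

-- Rank n (n ≥ 3, i.e. maximal singular subspaces have dimension n-1 ≥ 2);
-- every singular subspace lies in a maximal one (this, together with the
-- dimension bound, encodes the finiteness of flags).
HasRank : PolarSpace → ℕ → Set₁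
HasRank Π n = (3 ≤ n)
  × ((X : Point Π → Set) → SingSub Π X → Σ (Point Π → Set) λ Y → MaxSing Π Y × (X ⊆ Y))
  × ((X : Point Π → Set) → MaxSing Π X → Dim1 Π X n)

-- The graph Γ_{n-1}(Π) on 𝒢 n (maximal singular subspaces when rank n)

module _ (Π : PolarSpace) (n : ℕ) where
  Adj : 𝒢 Π n → 𝒢 Π n → Set₁
  Adj X Y = Dim1 Π (proj₁ X ∩ proj₁ Y) (n ∸ 1)

  Walk : 𝒢 Π n → 𝒢 Π n → ℕ → Set₁
  Walk X Y zero = Lift (lsuc lzero) (proj₁ X ≐ proj₁ Y)
  Walk X Y (suc k) = Σ (𝒢 Π n) λ Z → Adj X Z × Walk Z Y k

  Dist : 𝒢 Π n → 𝒢 Π n → ℕ → Set₁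
  Dist X Y k = Walk X Y k × (∀ j → j < k → ¬ Walk X Y j)

IsometricEmbedding : (Π : PolarSpace) (n : ℕ) (Π' : PolarSpace) (n' : ℕ) →
                     (𝒢 Π n → 𝒢 Π' n') → Set₁
IsometricEmbedding Π n Π' n' f =
  ∀ X Y k → (Dist Π n X Y k → Dist Π' n' (f X) (f Y) k)
          × (Dist Π' n' (f X) (f Y) k → Dist Π n X Y k)

IsFrame : ∀ {a ℓ ℓ'} {A : Set a} (_≈_ : A → A → Set ℓ) (_⊥'_ : A → A → Set ℓ')
          (n : ℕ) → (Fin (2 * n) → A) → Set (ℓ ⊔ ℓ')
IsFrame _≈_ _⊥'_ n p =
  (∀ i j → p i ≈ p j → i ≡ j)
  × (∀ i → Σ (Fin (2 * n)) λ j → ¬ (p i ⊥' p j) × (∀ k → ¬ (p i ⊥' p k) → k ≡ j))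

FrameΠ : (Π : PolarSpace) (n : ℕ) → (Fin (2 * n) → Point Π) → Set
FrameΠ Π n = IsFrame _≡_ (_⊥_ Π) n

-- The polar space [M⟩_{m-1} (m = dim + 1): points are elements of Star M m,
-- two points are equal iff equal as subsets, and collinear iff equal or both
-- contained in an element of Star M (m + 1) (i.e. lie on a common line).
StarEq : (Π' : PolarSpace) (M : Point Π' → Set) (m : ℕ) → Star Π' M m → Star Π' M m → Set₁
StarEq Π' M m A B = Lift (lsuc lzero) (proj₁ A ≐ proj₁ B)

StarColl : (Π' : PolarSpace) (M : Point Π' → Set) (m : ℕ) → Star Π' M m → Star Π' M m → Set₁
StarColl Π' M m A B = Lift (lsuc lzero) (proj₁ A ≐ proj₁ B)
  ⊎ (Σ (Star Π' M (suc m)) λ C → (proj₁ A ⊆ proj₁ C) × (proj₁ B ⊆ proj₁ C))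

FramesPreserving : (Π : PolarSpace) (n : ℕ) (Π' : PolarSpace) (M : Point Π' → Set) (m : ℕ) →
                   (Point Π → Star Π' M m) → Set₁
FramesPreserving Π n Π' M m g =
  ∀ (p : Fin (2 * n) → Point Π) → FrameΠ Π n p →
    IsFrame (StarEq Π' M m) (StarColl Π' M m) n (λ i → g (p i))

{-# OPTIONS --safe #-}
-- For a list L of mutually collinear points, the closure L^⊥⊥ is the subspace spanned by L; it has
-- the exchange property, and intersecting it with a hyperplane y^⊥ lowers the dimension by at most
-- one. All this is decidable, because the one-or-all axiom, being a disjunction, decides equality
-- of points. Consequently the distance of two generators S, T is n − dim (S ∩ T) (vector space
-- dimension), and f shifts the dimension of every S ∩ T by e = n' − n.
--
-- The key fact is that S ∩ T ⊆ X implies f S ∩ f T ⊆ f X. One walks from S to X: when S moves to a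
-- neighbour Z, the generator T can be moved to some T' with Z ∩ T' ⊆ S ∩ T and
-- f S ∩ f T ⊆ f Z ∩ f T', because generators on a geodesic contain the intersection of its ends
-- and three mutually adjacent generators share a hyperplane.
-- Then M = f S ∩ f T for opposite S, T and g p = f S ∩ f T for S ∩ T = {p} do not depend on choices.
-- If p ∉ T, a generator through p opposite T shows g p ⊈ f T; spanning and the preservation of
-- non-collinearity follow from this.
module Submission where

open import Defs
open import Level using (lift)
open import Data.Nat using (ℕ; zero; suc; _≤_; _<_; _∸_; _+_; _*_; z≤n; s≤s)
open import Data.Nat.Properties using (≤-refl; ≤-trans; ≤-reflexive; n≮n; m≤n⇒m≤1+n; m≤n⇒m<n∨m≡n; <⇒≱; <-cmp; m<m+n; m≤n+m)
open import Data.Nat.Properties using (+-suc; +-identityʳ; +-comm; +-assoc; +-monoˡ-≤; +-monoʳ-≤; +-cancelʳ-≡; +-cancelˡ-≤; +-cancelʳ-≤)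
open import Data.Nat.Properties using (m+[n∸m]≡n; m∸n+n≡m; +-∸-assoc; module ≤-Reasoning)
open import Data.Fin using (Fin; zero; suc)
open import Data.Product using (Σ; _×_; _,_; proj₁; proj₂)
open import Data.Sum using (_⊎_; inj₁; inj₂)
open import Data.Unit using (⊤; tt)
open import Data.Empty using (⊥; ⊥-elim)
open import Data.List using (List; []; _∷_; _++_; length; lookup; tabulate)
open import Data.List.Properties using (length-++; length-tabulate)
open import Data.List.Relation.Unary.All as All using (All; []; _∷_; all?)
open import Data.List.Relation.Unary.All.Properties using (++⁺; tabulate⁺; tabulate⁻; ¬All⇒Any¬)
open import Data.List.Relation.Unary.Any using (Any; here; there)
open import Data.List.Membership.Propositional.Properties using (∈-lookup)
open import Relation.Nullary using (¬_; Dec; yes; no)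
open import Relation.Binary.Definitions using (tri<; tri≈; tri>)
open import Relation.Binary.PropositionalEquality using (_≡_; _≢_; refl; sym; trans; cong; subst; module ≡-Reasoning)

-- Collinearity, lines, and equality of points on a line

module Collinearity (Π : PolarSpace) where
  open PolarSpace Π using () renaming (Point to Pt; Line to Ln; _I_ to _on_; _⊥_ to _∼_) public
  open PolarSpace Π using () renaming (nondegenerate to nondeg; one-or-all to oneOrAll) public

  _≁_ : Pt → Pt → Set
  x ≁ y = ¬ (x ∼ y)

  ∼-sym : ∀ {x y} → x ∼ y → y ∼ x
  ∼-sym (inj₁ e) = inj₁ (sym e)
  ∼-sym (inj₂ (l , p , q)) = inj₂ (l , q , p)

  on-∼ : ∀ {x y l} → x on l → y on l → x ∼ y
  on-∼ xl yl = inj₂ (_ , xl , yl)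

  line : ∀ {p q} → p ∼ q → p ≢ q → Σ Ln λ l → p on l × q on l
  line (inj₁ e) p≢q = ⊥-elim (p≢q e)
  line (inj₂ l) _ = l

  ∼-subspace : ∀ y → IsSubspace Π (y ∼_)
  ∼-subspace y l p q p≢q pl ql yp yq r rl with oneOrAll y l
  ... | inj₁ (c , _ , _ , u) = ⊥-elim (p≢q (trans (u p pl yp) (sym (u q ql yq))))
  ... | inj₂ all = all r rl

  ∼-line : ∀ {y p q r l} → p ≢ q → p on l → q on l → y ∼ p → y ∼ q → r on l → y ∼ r
  ∼-line p≢q pl ql yp yq rl = ∼-subspace _ _ _ _ p≢q pl ql yp yq _ rl

  point-subspace : ∀ q → IsSubspace Π (_≡ q)
  point-subspace q _ _ _ p≢p _ _ refl refl = ⊥-elim (p≢p refl)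

  foot : ∀ {y a l} → a on l → y ≁ a →
    Σ Pt λ c → c on l × y ∼ c × (∀ r → r on l → y ∼ r → r ≡ c)
  foot {y} {a} {l} al y≁a with oneOrAll y l
  ... | inj₁ c = c
  ... | inj₂ all = ⊥-elim (y≁a (all a al))

  -- A line through `y` has at least two points, all perpendicular to `y`; so this rules out the
  -- first alternative of the axiom there.
  on-not-one : ∀ {y c l} → y on l → ¬ (∀ r → r on l → y ∼ r → r ≡ c)
  on-not-one {l = l} yl u with PolarSpace.three-points Π l
  ... | a , b , _ , al , bl , _ , a≢b , _ =
    a≢b (trans (u a al (on-∼ yl al)) (sym (u b bl (on-∼ yl bl))))

  -- Either the test points exclude x ≡ y, or they produce a line m through x that is not
  -- perpendicular to l; then y ≡ x exactly when y is perpendicular to all of m.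
  abstract
    on-≟ : ∀ {x y l} → x on l → y on l → Dec (x ≡ y)
    on-≟ {x} {y} {l} xl yl with nondeg y
    ... | a , y≁a with foot yl (λ a∼y → y≁a (∼-sym a∼y))
    ... | u , ul , a∼u , u-one with nondeg u
    ... | b , u≁b with line a∼u (λ { refl → y≁a (on-∼ yl ul) })
    ... | k₁ , ak₁ , uk₁ with foot uk₁ (λ b∼u → u≁b (∼-sym b∼u))
    ... | v , vk₁ , b∼v , _ with line b∼v (λ { refl → u≁b (on-∼ uk₁ vk₁) })
    ... | k , bk , vk = decide
      where
      v≢u : v ≢ u
      v≢u refl = u≁b (∼-sym b∼v)

      toA : ∀ {z} → z on l → z ∼ v → z ∼ a
      toA zl z∼v = ∼-line v≢u vk₁ uk₁ z∼v (on-∼ zl ul) ak₁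

      decide : Dec (x ≡ y)
      decide with oneOrAll x k
      ... | inj₂ all = no λ { refl → y≁a (toA xl (all v vk)) }
      ... | inj₁ (w , wk , x∼w , _) with oneOrAll w l
      ...   | inj₂ all = no λ { refl → u≁b
                (∼-line (λ { refl → y≁a (toA xl x∼w) }) wk vk (∼-sym (all u ul)) (on-∼ uk₁ vk₁) bk) }
      ...   | inj₁ (t , _ , _ , t-one) = compare x∼w
        where
        x≡t : x ≡ t
        x≡t = t-one x xl (∼-sym x∼w)

        compare : x ∼ w → Dec (x ≡ y)
        compare (inj₁ refl) = yes (trans x≡t (sym (t-one y yl (on-∼ xl yl))))
        compare (inj₂ (m , xm , wm)) with oneOrAll y m
        ... | inj₂ all = yes (trans x≡t (sym (t-one y yl (∼-sym (all w wm)))))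
        ... | inj₁ (_ , _ , _ , one) = no λ { refl → on-not-one xm one }

-- Deciding collinearity and equality of points

module Rank (Π : PolarSpace) (n : ℕ) (rk : HasRank Π n) where
  open Collinearity Π public

  private
    3≤n : 3 ≤ n
    3≤n = proj₁ rk

  n≡1+ : n ≡ suc (n ∸ 1)
  n≡1+ = sym (m+[n∸m]≡n (≤-trans (s≤s z≤n) 3≤n))

  -- If the first two generators coincided, dropping the first would leave a smaller generating
  -- family.
  generators-distinct : ∀ {m} (X : Pt → Set) (v : Fin m → Pt) → GeneratedBy Π X v →
    (∀ k → k < m → ¬ (Σ (Fin k → Pt) λ w → GeneratedBy Π X w)) → 3 ≤ m →
    Σ Pt λ a → Σ Pt λ b → X a × X b × a ≢ b
  generators-distinct {suc (suc m)} X v (sp , gen) minimal _ =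
    v zero , v (suc zero) , sp _ (λ Y _ i → i _ (zero , refl)) , sp _ (λ Y _ i → i _ (suc zero , refl)) ,
    λ e → minimal (suc m) ≤-refl ((λ i → v (suc i)) ,
      (λ x s → sp x (λ Y Ys i → s Y Ys (λ { _ (j , refl) → i _ (suc j , refl) }))) ,
      (λ x Xx Y Ys i → gen x Xx Y Ys
        (λ { _ (zero , refl) → subst Y (sym e) (i _ (zero , refl)) ; _ (suc j , refl) → i _ (j , refl) })))
  generators-distinct {suc zero} X v _ _ (s≤s ())

  -- The point `q` lies in a maximal singular subspace with distinct points `a`, `b`. Equality is
  -- not yet decidable, so the line is read off from the proofs of `q ∼ a` and `q ∼ b`.
  line-through : ∀ q → Σ Ln λ l → q on l
  line-through q with proj₁ (proj₂ rk) (_≡ q)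
      (point-subspace q , (λ { _ _ refl refl → inj₁ refl }))
  ... | Y , maxY , q⊆Y with proj₂ (proj₂ rk) Y maxY
  ... | (v , gen) , minimal with generators-distinct Y v gen minimal 3≤n
  ... | a , b , Ya , Yb , a≢b = pick (sing q a (q⊆Y q refl) Ya) (sing q b (q⊆Y q refl) Yb)
    where
    sing = proj₂ (proj₁ maxY)
    pick : q ∼ a → q ∼ b → Σ Ln λ l → q on l
    pick (inj₂ (l , ql , _)) _ = l , ql
    pick (inj₁ _) (inj₂ (l , ql , _)) = l , ql
    pick (inj₁ refl) (inj₁ refl) = ⊥-elim (a≢b refl)

  abstract
    _∼?_ : ∀ p q → Dec (p ∼ q)
    p ∼? q with line-through q
    ... | l , ql with oneOrAll p l
    ... | inj₂ all = yes (all q ql)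
    ... | inj₁ (r , rl , p∼r , one) with on-≟ rl ql
    ... | yes refl = yes p∼r
    ... | no r≢q = no λ p∼q → r≢q (sym (one q ql p∼q))

  abstract
    _≟_ : (p q : Pt) → Dec (p ≡ q)
    p ≟ q with p ∼? q
    ... | no p≁q = no λ { refl → p≁q (inj₁ refl) }
    ... | yes (inj₁ e) = yes e
    ... | yes (inj₂ (_ , pl , ql)) = on-≟ pl ql

  -- Closures

  _∼*_ : Pt → List Pt → Set
  y ∼* L = All (y ∼_) L

  -- Unlike `Span`, which quantifies over subspaces, this lives in `Set`, so it can itself serve as
  -- one of the subspaces that `Span` tests.
  cl : List Pt → Pt → Set
  cl L z = ∀ y → y ∼* L → y ∼ z

  Clique : List Pt → Set
  Clique [] = ⊤
  Clique (a ∷ L) = a ∼* L × Clique L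

  Ind : List Pt → Set
  Ind [] = ⊤
  Ind (a ∷ L) = a ∼* L × ¬ cl L a × Ind L

  Ind⇒Clique : ∀ L → Ind L → Clique L
  Ind⇒Clique [] _ = tt
  Ind⇒Clique (a ∷ L) (p , _ , i) = p , Ind⇒Clique L i

  ∼*-line : ∀ {p q r l L} → p ≢ q → p on l → q on l → p ∼* L → q ∼* L → r on l → r ∼* L
  ∼*-line p≢q pl ql pL qL rl =
    All.zipWith (λ { (pe , qe) → ∼-sym (∼-line p≢q pl ql (∼-sym pe) (∼-sym qe) rl) }) (pL , qL)

  cl-subspace : ∀ L → IsSubspace Π (cl L)
  cl-subspace L l p q p≢q pl ql cp cq r rl y yL = ∼-line p≢q pl ql (cp y yL) (cq y yL) rl

  cl-head : ∀ {a L} → cl (a ∷ L) a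
  cl-head _ (p ∷ _) = p

  cl-tail : ∀ {a L} → cl L ⊆ cl (a ∷ L)
  cl-tail z c y (_ ∷ p) = c y p

  cl-self : ∀ L → All (cl L) L
  cl-self [] = []
  cl-self (a ∷ L) = cl-head ∷ All.map (λ {x} → cl-tail x) (cl-self L)

  cl-mono : ∀ {K L} → All (cl L) K → cl K ⊆ cl L
  cl-mono h z c y yL = c y (All.map (λ d → d y yL) h)

  clique-∼* : ∀ L → Clique L → All (_∼* L) L
  clique-∼* [] _ = []
  clique-∼* (a ∷ L) (aL , cL) =
    (inj₁ refl ∷ aL) ∷ All.zipWith (λ { (ae , eL) → ∼-sym ae ∷ eL }) (aL , clique-∼* L cL)

  cl-∼* : ∀ {L z} → Clique L → cl L z → z ∼* L
  cl-∼* cL c = All.map (λ eL → ∼-sym (c _ eL)) (clique-∼* _ cL)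

  cl-singular : ∀ L → Clique L → Singular Π (cl L)
  cl-singular L cL x z cx cz = cz x (cl-∼* cL cx)

  cl-[] : ∀ {z} → ¬ cl [] z
  cl-[] {z} c with nondeg z
  ... | y , z≁y = z≁y (∼-sym (c y []))

  -- The line rz below stays in L^⊥ and avoids b^⊥ except at r, while r ≁ a,
  -- so its point perpendicular to a is a witness even when y ≁ z.
  abstract
    separate-both : ∀ {L a b y z} → a ∼ b → b ∼* L → y ∼* L → y ≁ a → y ∼ b → z ∼* L → z ≁ b →
      Σ Pt λ w → w ∼* (a ∷ L) × w ≁ b
    separate-both {L} {a} {b} {y} {z} a∼b bL yL y≁a y∼b zL z≁b
      with line y∼b (λ { refl → y≁a (∼-sym a∼b) })
    ... | l , yl , bl with foot bl z≁b
    ... | r , rl , z∼r , _ with line z∼r (λ { refl → z≁b (on-∼ rl bl) })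
    ... | k , zk , rk' = answer
      where
      y≢b : y ≢ b
      y≢b refl = y≁a (∼-sym a∼b)
      r≢b : r ≢ b
      r≢b refl = z≁b z∼r
      z≢r : z ≢ r
      z≢r refl = z≁b (on-∼ rl bl)
      rL : r ∼* L
      rL = ∼*-line y≢b yl bl yL bL rl
      a≁r : a ≁ r
      a≁r a∼r = y≁a (∼-sym (∼-line r≢b rl bl a∼r a∼b yl))
      answer : Σ Pt λ w → w ∼* (a ∷ L) × w ≁ b
      answer with foot rk' a≁r
      ... | s , sk , a∼s , _ = s , (∼-sym a∼s ∷ ∼*-line z≢r zk rk' zL rL sk) ,
        λ s∼b → z≁b (∼-sym (∼-line (λ { refl → a≁r a∼s }) sk rk' (∼-sym s∼b) (on-∼ bl rl) zk))

  abstract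
    -- If `y` is in L^⊥ but not perpendicular to `a`, then `b` is projected from `a` to the point
    -- `b'` of y^⊥. Membership of `b` in `cl (a ∷ L)` amounts to membership of `b'` in `cl L`, which
    -- the induction settles.
    separate : ∀ L → Clique L → ∀ b → b ∼* L → (Σ Pt λ y → y ∼* L × y ≁ b) ⊎ cl L b
    separate [] _ b _ with nondeg b
    ... | y , b≁y = inj₁ (y , [] , λ y∼b → b≁y (∼-sym y∼b))
    separate (a ∷ L) (aL , cL) b (b∼a ∷ bL) with separate L cL a aL
    separate (a ∷ L) (aL , cL) b (b∼a ∷ bL) | inj₂ a∈ with separate L cL b bL
    ... | inj₁ (y , yL , y≁b) = inj₁ (y , a∈ y yL ∷ yL , y≁b)
    ... | inj₂ b∈ = inj₂ (cl-tail b b∈)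
    separate (a ∷ L) (aL , cL) b (b∼a ∷ bL) | inj₁ (y , yL , y≁a) with b ≟ a
    ... | yes refl = inj₂ cl-head
    ... | no b≢a with line b∼a b≢a
    ... | l , bl , al with foot al y≁a
    ... | b' , b'l , y∼b' , _ = answer
      where
      b'L : b' ∼* L
      b'L = ∼*-line b≢a bl al bL aL b'l
      a≢b' : a ≢ b'
      a≢b' refl = y≁a y∼b'
      answer : (Σ Pt λ y → y ∼* (a ∷ L) × y ≁ b) ⊎ cl (a ∷ L) b
      answer with separate L cL b' b'L
      ... | inj₂ b'∈ = inj₂ λ { z (z∼a ∷ zL) → ∼-line a≢b' al b'l z∼a (b'∈ z zL) bl }
      ... | inj₁ (z , zL , z≁b') with separate-both (on-∼ al b'l) b'L yL y≁a y∼b' zL z≁b'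
      ... | w , wL@(w∼a ∷ _) , w≁b' = inj₁ (w , wL , λ w∼b → w≁b' (∼-line b≢a bl al w∼b w∼a b'l))

  data Join (a : Pt) (X : Pt → Set) : Pt → Set where
    inside : ∀ {z} → X z → Join a X z
    vertex : Join a X a
    joined : ∀ {z} c l → X c → a ≢ c → a on l → c on l → z on l → Join a X z

  abstract
    -- For `a` outside `cl L`, the point `c` is where the line `za` meets y^⊥. A point perpendicular
    -- to `a` and `L` is perpendicular to `z`, hence to `c`; so `separate-both` would contradict `c`
    -- being outside `cl L`.
    join : ∀ {a L z} → Clique (a ∷ L) → cl (a ∷ L) z → Join a (cl L) z
    join {a} {L} {z} (aL , cL) z∈ with separate L cL a aL
    ... | inj₂ a∈ = inside λ y yL → z∈ y (a∈ y yL ∷ yL)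
    ... | inj₁ (y , yL , y≁a) with z ≟ a
    ... | yes refl = vertex
    ... | no z≢a with cl-∼* (aL , cL) z∈
    ... | z∼a ∷ zL with line z∼a z≢a
    ... | l , zl , al with foot al y≁a
    ... | c , c-on , y∼c , _ with ∼*-line z≢a zl al zL aL c-on
    ... | c∼L with separate L cL c c∼L
    ... | inj₂ c∈ = joined c l c∈ (λ { refl → y≁a y∼c }) al c-on zl
    ... | inj₁ (w , wL , w≁c) with separate-both (on-∼ al c-on) c∼L yL y≁a y∼c wL w≁c
    ... | x , xL@(x∼a ∷ _) , x≁c = ⊥-elim (x≁c (∼-line z≢a zl al (z∈ x xL) x∼a c-on))

  -- With `cl-subspace` this identifies L^⊥⊥ with the span of a clique.
  cl-min : ∀ {b} {Y : Pt → Set b} → IsSubspace Π Y → ∀ L → Clique L → All Y L → cl L ⊆ Y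
  cl-min Ys [] _ _ z c = ⊥-elim (cl-[] c)
  cl-min Ys (a ∷ L) cL (Ya ∷ YL) z c with join cL c
  ... | inside c' = cl-min Ys L (proj₂ cL) YL z c'
  ... | vertex = Ya
  ... | joined d l d∈ a≢d al dl zl =
    Ys l a d a≢d al dl Ya (cl-min Ys L (proj₂ cL) YL d d∈) z zl

  abstract
    cl? : ∀ L → Clique L → ∀ z → Dec (cl L z)
    cl? L cL z with all? (z ∼?_) L
    ... | no z≁L = no λ c → z≁L (cl-∼* cL c)
    ... | yes zL with separate L cL z zL
    ... | inj₂ c = yes c
    ... | inj₁ (y , yL , y≁z) = no λ c → y≁z (c y yL)

  -- A point `z` of `T` outside `cl L` is joined to some `c` in `cl L` by a line through `a`, and
  -- this line would lie in `T`.
  cl-hyperplane : ∀ {a L} {T : Pt → Set} → Clique (a ∷ L) → IsSubspace Π T → cl L ⊆ T → ¬ T a →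
    ∀ z → cl (a ∷ L) z → T z → cl L z
  cl-hyperplane cL Ts L⊆T a∉T z z∈ Tz with join cL z∈
  ... | inside c = c
  ... | vertex = ⊥-elim (a∉T Tz)
  ... | joined c l c∈ _ al c-on zl with z ≟ c
  ... | yes refl = c∈
  ... | no z≢c = ⊥-elim (a∉T (Ts l z c z≢c zl c-on Tz (L⊆T c c∈) _ al))

  -- The modular law: a ∨ L meets a subspace through `a` in a ∨ (L ∩ T).
  cl-modular : ∀ {a L K} {T : Pt → Set} → Clique (a ∷ L) → IsSubspace Π T → T a →
    (cl L ∩ T) ⊆ cl K → ∀ z → cl (a ∷ L) z → T z → cl (a ∷ K) z
  cl-modular {a} cL Ts Ta sub z z∈ Tz with join cL z∈
  ... | inside c = cl-tail z (sub z (c , Tz))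
  ... | vertex = cl-head
  ... | joined c l c∈ a≢c al c-on zl with z ≟ a
  ... | yes refl = cl-head
  ... | no z≢a = λ { y (y∼a ∷ yK) →
    ∼-line a≢c al c-on y∼a (sub c (c∈ , Ts l z _ z≢a zl al Tz Ta c c-on) y yK) zl }

  -- Dimension

  abstract
    -- The point `b` off y^⊥ is returned for the induction: the line `ab` has a point `a'` in y^⊥,
    -- and exchanging `a` for `a'` extends the basis `K` of the section.
    cut : ∀ L → Ind L → ∀ y → (y ∼* L) ⊎
      ((Σ (List Pt) λ K → Ind K × length L ≡ suc (length K) × (cl K ≐ (cl L ∩ (y ∼_))))
       × Σ Pt λ b → cl L b × y ≁ b)
    cut [] _ y = inj₁ []
    cut (a ∷ L) (aL , a∉ , iL) y with cut L iL y
    cut (a ∷ L) (aL , a∉ , iL) y | inj₁ yL with y ∼? a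
    ... | yes y∼a = inj₁ (y∼a ∷ yL)
    ... | no y≁a = inj₂ ((L , iL , refl ,
        (λ z c → cl-tail z c , c y yL) ,
        (λ { z (c , y∼z) → cl-hyperplane (aL , Ind⇒Clique L iL) (∼-subspace y) (λ x d → d y yL) y≁a z c y∼z })) ,
        a , cl-head , y≁a)
    cut (a ∷ L) (aL , a∉ , iL) y | inj₂ ((K , iK , len , (K⊆ , ⊆K)) , b , b∈ , y≁b)
      with line (∼-sym (b∈ a aL)) (λ { refl → a∉ b∈ })
    ... | l , bl , al with foot bl y≁b
    ... | a' , a'l , y∼a' , _ = inj₂ ((a' ∷ K , (a'K , a'∉K , iK) , cong suc len , sub , sup) , b , cl-tail b b∈ , y≁b)
      where
      cL : Clique L
      cL = Ind⇒Clique L iL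
      b≢a : b ≢ a
      b≢a refl = a∉ b∈
      a'≢b : a' ≢ b
      a'≢b refl = y≁b y∼a'
      a'L : a' ∼* L
      a'L = ∼*-line b≢a bl al (cl-∼* cL b∈) aL a'l
      a'∉L : ¬ cl L a'
      a'∉L c = a∉ (cl-subspace L l a' b a'≢b a'l bl c b∈ a al)
      K⊆L : cl K ⊆ cl L
      K⊆L z c = proj₁ (K⊆ z c)
      a'K : a' ∼* K
      a'K = All.map (λ c → proj₁ (K⊆ _ c) a' a'L) (cl-self K)
      a'∉K : ¬ cl K a'
      a'∉K c = a'∉L (K⊆L a' c)
      a'∈ : cl (a ∷ L) a'
      a'∈ x (x∼a ∷ xL) = ∼-line b≢a bl al (b∈ x xL) x∼a a'l
      sub : cl (a' ∷ K) ⊆ (cl (a ∷ L) ∩ (y ∼_))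
      sub z c = (λ x xL → c x (a'∈ x xL ∷ All.map (λ d → proj₁ (K⊆ _ d) x (All.tail xL)) (cl-self K))) ,
                c y (y∼a' ∷ All.map (λ d → proj₂ (K⊆ _ d)) (cl-self K))
      exch : cl (a ∷ L) ⊆ cl (a' ∷ L)
      exch z c x (x∼a' ∷ xL) = c x (∼-line a'≢b a'l bl x∼a' (b∈ x xL) al ∷ xL)
      sup : (cl (a ∷ L) ∩ (y ∼_)) ⊆ cl (a' ∷ K)
      sup z (c , y∼z) = cl-modular (a'L , cL) (∼-subspace y) y∼a' ⊆K z (exch z c) y∼z

  abstract
    -- Choose `y` perpendicular to `W` but not to `w`. Cutting with y^⊥ brings `cl (w ∷ W)` into
    -- `cl W`, while `L` loses at most one point.
    steinitz : ∀ W → Clique W → ∀ L → Ind L → All (cl W) L → length L ≤ length W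
    steinitz [] _ [] _ _ = z≤n
    steinitz [] _ (a ∷ L) _ (c ∷ _) = ⊥-elim (cl-[] c)
    steinitz (w ∷ W) (wW , cW) L iL h with separate W cW w wW
    ... | inj₂ w∈ = m≤n⇒m≤1+n (steinitz W cW L iL (All.map (λ c y yW → c y (w∈ y yW ∷ yW)) h))
    ... | inj₁ (y , yW , y≁w) = answer
      where
      drop : ∀ z → cl (w ∷ W) z → y ∼ z → cl W z
      drop = cl-hyperplane (wW , cW) (∼-subspace y) (λ x d → d y yW) y≁w
      answer : length L ≤ suc (length W)
      answer with cut L iL y
      ... | inj₁ yL = m≤n⇒m≤1+n (steinitz W cW L iL (All.zipWith (λ { {z} (c , y∼z) → drop z c y∼z }) (h , yL)))
      ... | inj₂ ((K , iK , len , (K⊆ , _)) , _) = subst (_≤ suc (length W)) (sym len)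
        (s≤s (steinitz W cW K iK (All.map
          (λ {z} d → drop z (cl-mono h z (proj₁ (K⊆ z d))) (proj₂ (K⊆ z d))) (cl-self K))))

-- Bases of singular subspaces

module Generators (Π : PolarSpace) (n : ℕ) (rk : HasRank Π n) where
  open Rank Π n rk public

  -- A positive substitute for `Dim1`, whose minimality clause is a negation; `dim1⇒basis` and
  -- `basis⇒dim1` translate between them.
  record Basis (X : Pt → Set) (m : ℕ) : Set where
    constructor mkBasis
    field
      pts : List Pt
      ind : Ind pts
      size : length pts ≡ m
      sound : cl pts ⊆ X
      complete : X ⊆ cl pts

    clique : Clique pts
    clique = Ind⇒Clique pts ind

    members : All X pts
    members = All.map (λ {x} → sound x) (cl-self pts)

  open Basis public

  basis-cong : ∀ {X Y m} → X ≐ Y → Basis X m → Basis Y m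
  basis-cong (X⊆Y , Y⊆X) (mkBasis L i s l u) =
    mkBasis L i s (λ z c → X⊆Y z (l z c)) (λ z y → u z (Y⊆X z y))

  basis-cl : ∀ {L} → Ind L → Basis (cl L) (length L)
  basis-cl {L} iL = mkBasis L iL refl (λ _ c → c) (λ _ c → c)

  basis-subspace : ∀ {X m} → Basis X m → IsSubspace Π X
  basis-subspace B l p q p≢q pl ql Xp Xq r rl =
    sound B r (cl-subspace (pts B) l p q p≢q pl ql (complete B p Xp) (complete B q Xq) r rl)

  basis-singsub : ∀ {X m} → Basis X m → SingSub Π X
  basis-singsub B = basis-subspace B ,
    λ p q Xp Xq → cl-singular (pts B) (clique B) p q (complete B p Xp) (complete B q Xq)

  basis? : ∀ {X m} → Basis X m → ∀ z → Dec (X z)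
  basis? B z with cl? (pts B) (clique B) z
  ... | yes c = yes (sound B z c)
  ... | no ¬c = no λ Xz → ¬c (complete B z Xz)

  abstract
    dim-≤ : ∀ {X Y k m} → Basis X k → Basis Y m → X ⊆ Y → k ≤ m
    dim-≤ (mkBasis K iK refl lK _) (mkBasis L iL refl _ uL) X⊆Y =
      steinitz L (Ind⇒Clique L iL) K iK (All.map (λ c → uL _ (X⊆Y _ (lK _ c))) (cl-self K))

  grow : ∀ {X k a} (B : Basis X k) → ¬ X a → (∀ x → X x → a ∼ x) → Basis (cl (a ∷ pts B)) (suc k)
  grow {a = a} B a∉X a∼X = mkBasis (a ∷ pts B)
    (All.map (λ {x} → a∼X x) (members B) , (λ c → a∉X (sound B a c)) , ind B)
    (cong suc (size B)) (λ _ c → c) (λ _ c → c)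

  abstract
    dim-full : ∀ {X Y k} → Basis X k → Basis Y k → X ⊆ Y → Y ⊆ X
    dim-full {Y = Y} {k = k} BX BY X⊆Y z Yz with basis? BX z
    ... | yes Xz = Xz
    ... | no z∉X = ⊥-elim (n≮n k (dim-≤ (grow BX z∉X λ x Xx → sing z x Yz (X⊆Y x Xx)) BY
          (cl-min (basis-subspace BY) (z ∷ pts BX)
            (All.map (λ {x} Xx → sing z x Yz (X⊆Y x Xx)) (members BX) , clique BX)
            (Yz ∷ All.map (λ {x} → X⊆Y x) (members BX)))))
      where
      sing : Singular Π Y
      sing = proj₂ (basis-singsub BY)

  abstract
    find : ∀ {X Y : Pt → Set} {k} → Basis X k → IsSubspace Π Y → (∀ z → Dec (Y z)) →
      (X ⊆ Y) ⊎ Σ Pt λ x → X x × ¬ Y x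
    find {X} {Y} B Ys Y? with all? Y? (pts B)
    ... | yes YL = inj₁ λ z Xz → cl-min Ys (pts B) (clique B) YL z (complete B z Xz)
    ... | no ¬YL = inj₂ (pick (¬All⇒Any¬ Y? (pts B) ¬YL) (members B))
      where
      pick : ∀ {L} → Any (λ x → ¬ Y x) L → All X L → Σ Pt λ x → X x × ¬ Y x
      pick (here ¬Yx) (Xx ∷ _) = _ , Xx , ¬Yx
      pick (there a) (_ ∷ Xs) = pick a Xs

  abstract
    extra : ∀ {X Y k m} → Basis X k → Basis Y m → m < k → Σ Pt λ x → X x × ¬ Y x
    extra BX BY m<k with find BX (basis-subspace BY) (basis? BY)
    ... | inj₁ X⊆Y = ⊥-elim (<⇒≱ m<k (dim-≤ BX BY X⊆Y))
    ... | inj₂ x = x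

  abstract
    hyperplane : ∀ {X k} → Basis X k → ∀ y →
      (X ⊆ (y ∼_)) ⊎ Σ ℕ λ j → k ≡ suc j × Basis (X ∩ (y ∼_)) j
    hyperplane (mkBasis L iL refl l u) y with cut L iL y
    ... | inj₁ yL = inj₁ λ z Xz → u z Xz y yL
    ... | inj₂ ((K , iK , len , K⊆ , ⊆K) , _) = inj₂ (length K , len , mkBasis K iK refl
            (λ z c → l z (proj₁ (K⊆ z c)) , proj₂ (K⊆ z c)) (λ { z (Xz , y∼z) → ⊆K z (u z Xz , y∼z) }))

  abstract
    hyperplanes : ∀ {X k} ys → Basis X k →
      Σ ℕ λ j → Basis (X ∩ (_∼* ys)) j × k ≤ j + length ys
    hyperplanes {X} {k} [] B = k , basis-cong ((λ _ Xz → Xz , []) , (λ _ → proj₁)) B , ≤-reflexive (sym (+-identityʳ k))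
    hyperplanes {X} {k} (y ∷ ys) B with hyperplanes ys B
    ... | j , B' , k≤ with hyperplane B' y
    ... | inj₁ ⊆y = j , basis-cong ((λ { z (Xz , zs) → Xz , ∼-sym (⊆y z (Xz , zs)) ∷ zs }) , (λ { z (Xz , _ ∷ zs) → Xz , zs })) B'
          , ≤-trans k≤ (+-monoʳ-≤ j (m≤n⇒m≤1+n ≤-refl))
    ... | inj₂ (i , refl , B'') = i , basis-cong ((λ { z ((Xz , zs) , y∼z) → Xz , ∼-sym y∼z ∷ zs })
          , (λ { z (Xz , z∼y ∷ zs) → (Xz , zs) , ∼-sym z∼y })) B''
          , subst (k ≤_) (sym (+-suc i (length ys))) k≤

  abstract
    -- A point of `V` is kept only if it is outside the closure of those already chosen. With
    -- `P = []` this extracts a basis from a generating family.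
    extend : ∀ {X : Pt → Set} → SingSub Π X → ∀ V → All X V → ∀ P → Ind P → All X P →
      Σ (List Pt) λ B → Ind (B ++ P) × All X B × All (cl (B ++ P)) V
    extend Xs [] _ P iP _ = [] , iP , [] , []
    extend Xs (v ∷ V) (Xv ∷ XV) P iP XP with extend Xs V XV P iP XP
    ... | B , iB , XB , VB with cl? (B ++ P) (Ind⇒Clique (B ++ P) iB) v
    ... | yes c = B , iB , XB , c ∷ VB
    ... | no ¬c = v ∷ B , (All.map (λ {x} → proj₂ Xs v x Xv) (++⁺ XB XP) , ¬c , iB) , Xv ∷ XB ,
                  cl-head ∷ All.map (λ {x} → cl-tail x) VB

  all-lookup : ∀ {Y : Pt → Set} L → (∀ i → Y (lookup L i)) → All Y L
  all-lookup [] h = []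
  all-lookup (a ∷ L) h = h zero ∷ all-lookup L (λ i → h (suc i))

  generated-lookup : ∀ {X} → IsSubspace Π X → ∀ L → Clique L → cl L ≐ X → GeneratedBy Π X (lookup L)
  generated-lookup Xs L cL (l , u) =
    (λ x s → s _ Xs λ { _ (i , refl) → l _ (All.lookup (cl-self L) (∈-lookup i)) }) ,
    (λ x Xx Y Ys h → cl-min Ys L cL (all-lookup L λ i → h _ (i , refl)) x (u x Xx))

  singular-clique : ∀ {X : Pt → Set} → Singular Π X → ∀ L → All X L → Clique L
  singular-clique s [] _ = tt
  singular-clique s (a ∷ L) (Xa ∷ XL) = All.map (λ {x} → s a x Xa) XL , singular-clique s L XL

  module _ {X : Pt → Set} (Xs : SingSub Π X) {m : ℕ} (v : Fin m → Pt) (gv : GeneratedBy Π X v) where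
    generators-in : All X (tabulate v)
    generators-in = tabulate⁺ λ i → proj₁ gv _ λ Y _ h → h _ (i , refl)

    generators-clique : Clique (tabulate v)
    generators-clique = singular-clique (proj₂ Xs) (tabulate v) generators-in

    generators-cl : X ⊆ cl (tabulate v)
    generators-cl x Xx = proj₂ gv x Xx _ (cl-subspace (tabulate v))
      λ { _ (i , refl) → tabulate⁻ (cl-self (tabulate v)) i }

  abstract
    dim1⇒basis : ∀ {X m} → SingSub Π X → Dim1 Π X m → Basis X m
    dim1⇒basis {X} {m} Xs ((v , gv) , minimal)
      with extend Xs (tabulate v) (generators-in Xs v gv) [] tt []
    ... | B , iB , XB , VB = mkBasis (B ++ []) iB exact (proj₁ cl≐X) (proj₂ cl≐X)
      where
      cl≐X : cl (B ++ []) ≐ X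
      cl≐X = cl-min (proj₁ Xs) (B ++ []) (Ind⇒Clique _ iB) (++⁺ XB []) ,
             λ x Xx → cl-mono VB x (generators-cl Xs v gv x Xx)
      exact : length (B ++ []) ≡ m
      exact with m≤n⇒m<n∨m≡n (subst (length (B ++ []) ≤_) (length-tabulate v)
        (steinitz (tabulate v) (generators-clique Xs v gv) (B ++ []) iB
          (All.map (λ {x} → generators-cl Xs v gv x) (++⁺ XB []))))
      ... | inj₂ e = e
      ... | inj₁ less = ⊥-elim (minimal _ less (_ , generated-lookup (proj₁ Xs) _ (Ind⇒Clique _ iB) cl≐X))

  abstract
    basis⇒dim1 : ∀ {X m} → Basis X m → Dim1 Π X m
    basis⇒dim1 {X} B@(mkBasis L iL refl l u) =
      (lookup L , generated-lookup (basis-subspace B) L (Ind⇒Clique L iL) (l , u)) ,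
      λ { k k< (w , gw) → <⇒≱ k< (subst (length L ≤_) (length-tabulate w)
          (steinitz (tabulate w) (generators-clique (basis-singsub B) w gw) L iL
            (All.map (λ {x} c → generators-cl (basis-singsub B) w gw x (l x c)) (cl-self L)))) }

  -- Maximal singular subspaces

  Gen : Set₁
  Gen = 𝒢 Π n

  ⟦_⟧ : Gen → Pt → Set
  ⟦ S ⟧ = proj₁ S

  abstract
    basisOf : (S : Gen) → Basis ⟦ S ⟧ n
    basisOf (X , Xs , d) = dim1⇒basis Xs d

  generator : ∀ {X} → Basis X n → Gen
  generator {X} B = X , basis-singsub B , basis⇒dim1 B

  subspace : (S : Gen) → IsSubspace Π ⟦ S ⟧
  subspace S = proj₁ (proj₁ (proj₂ S))

  singular : (S : Gen) → ∀ {x y} → ⟦ S ⟧ x → ⟦ S ⟧ y → x ∼ y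
  singular S = proj₂ (proj₁ (proj₂ S)) _ _

  _∈?_ : ∀ z (S : Gen) → Dec (⟦ S ⟧ z)
  z ∈? S = basis? (basisOf S) z

  abstract
    enlarge : ∀ {L} → Ind L → Σ Gen λ U → cl L ⊆ ⟦ U ⟧
    enlarge {L} iL with proj₁ (proj₂ rk) (cl L) (basis-singsub (basis-cl iL))
    ... | Y , maxY , L⊆Y = (Y , proj₁ maxY , proj₂ (proj₂ rk) Y maxY) , L⊆Y

  ind-bound : ∀ {L} → Ind L → length L ≤ n
  ind-bound iL with enlarge iL
  ... | U , L⊆U = dim-≤ (basis-cl iL) (basisOf U) L⊆U

  abstract
    -- Otherwise `z` and a basis of `S` would be n + 1 independent points.
    maximal : (S : Gen) → ∀ z → z ∼* pts (basisOf S) → ⟦ S ⟧ z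
    maximal S z zS with z ∈? S
    ... | yes Sz = Sz
    ... | no z∉S = ⊥-elim (n≮n n (subst (_< n) (size B) (ind-bound {z ∷ pts B} (zS , (λ c → z∉S (sound B z c)) , ind B))))
      where
      B : Basis ⟦ S ⟧ n
      B = basisOf S

  abstract
    -- By maximality `T` is the set of points perpendicular to its basis, so the intersection arises
    -- from `S` by cutting with hyperplanes.
    meet : (S T : Gen) → Σ ℕ λ k → Basis (⟦ S ⟧ ∩ ⟦ T ⟧) k
    meet S T with hyperplanes (pts (basisOf T)) (basisOf S)
    ... | k , B , _ = k , basis-cong ((λ { z (Sz , zT) → Sz , maximal T z zT }) ,
      (λ { z (Sz , Tz) → Sz , All.map (λ {x} → singular T Tz) (members (basisOf T)) })) B

  ∩-swap : {X Y : Pt → Set} {m : ℕ} → Basis (X ∩ Y) m → Basis (Y ∩ X) m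
  ∩-swap = basis-cong ((λ { _ (x , y) → y , x }) , (λ { _ (x , y) → y , x }))

  n∸1<n : n ∸ 1 < n
  n∸1<n = ≤-reflexive (sym n≡1+)

  module _ (S : Gen) (b : Pt) (b∉S : ¬ ⟦ S ⟧ b) where
    abstract
      perp-hyperplane : Basis (⟦ S ⟧ ∩ (b ∼_)) (n ∸ 1)
      perp-hyperplane with hyperplane (basisOf S) b
      ... | inj₁ S⊆b = ⊥-elim (b∉S (maximal S b (All.map (λ {x} → S⊆b x) (members (basisOf S)))))
      ... | inj₂ (j , e , B) = subst (Basis _) (sym (cong (_∸ 1) e)) B

      -- The generator spanned by b and the hyperplane b^⊥ ∩ S of S.
      swap : Gen
      swap = generator (subst (Basis _) (sym n≡1+) (grow perp-hyperplane (λ { (Sb , _) → b∉S Sb }) (λ _ → proj₂)))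

      swap-clique : Clique (b ∷ pts perp-hyperplane)
      swap-clique = All.map proj₂ (members perp-hyperplane) , clique perp-hyperplane

      swap-new : ⟦ swap ⟧ b
      swap-new _ (p ∷ _) = p

      swap-old : ∀ {x} → ⟦ S ⟧ x → b ∼ x → ⟦ swap ⟧ x
      swap-old Sx b∼x = cl-tail _ (complete perp-hyperplane _ (Sx , b∼x))

      swap-adj : Basis (⟦ S ⟧ ∩ ⟦ swap ⟧) (n ∸ 1)
      swap-adj = basis-cong ((λ { z (Sz , b∼z) → Sz , swap-old Sz b∼z }) ,
        (λ { z (Sz , Zz) → Sz , singular swap swap-new Zz })) perp-hyperplane

      -- Since `b` is in `T`, all of S ∩ T is perpendicular to `b`, and the modular law gives b ∨ (S
      -- ∩ T).
      swap-meet : (T : Gen) → ⟦ T ⟧ b → ∀ {d} → Basis (⟦ S ⟧ ∩ ⟦ T ⟧) d → Basis (⟦ swap ⟧ ∩ ⟦ T ⟧) (suc d)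
      swap-meet T Tb {d} B = basis-cong
        ((λ z c → cl-min (subspace swap) L cL (swap-new ∷ All.map (λ { (Sx , Tx) → swap-old Sx (singular T Tb Tx) }) (members B)) z c
                , cl-min (subspace T) L cL (Tb ∷ All.map proj₂ (members B)) z c) ,
         (λ { z (Zz , Tz) → cl-modular swap-clique (subspace T) Tb
                (λ { x (c , Tx) → complete B x (proj₁ (sound perp-hyperplane x c) , Tx) }) z Zz Tz }))
        G
        where
        G : Basis (cl (b ∷ pts B)) (suc d)
        G = grow B (λ { (Sb , _) → b∉S Sb }) (λ { _ (_ , Tx) → singular T Tb Tx })
        L : List Pt
        L = b ∷ pts B
        cL : Clique L
        cL = clique G

      swap-cut : ∀ {T : Pt → Set} → IsSubspace Π T → (∀ x → ⟦ S ⟧ x → b ∼ x → T x) → ¬ T b →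
        ∀ {z} → ⟦ swap ⟧ z → T z → ⟦ S ⟧ z
      swap-cut Ts h b∉T {z} Zz Tz = proj₁ (sound perp-hyperplane z
        (cl-hyperplane swap-clique Ts (λ x c → let Sx , b∼x = sound perp-hyperplane x c in h x Sx b∼x) b∉T z Zz Tz))

      -- S ∩ Z lies in S ∩ b^⊥ and has the same dimension, so `Z` contains both `b` and this
      -- hyperplane.
      swap-unique : (Z : Gen) → ⟦ Z ⟧ b → Basis (⟦ S ⟧ ∩ ⟦ Z ⟧) (n ∸ 1) → ⟦ swap ⟧ ≐ ⟦ Z ⟧
      swap-unique Z Zb adj = swap⊆Z , dim-full (basisOf swap) (basisOf Z) swap⊆Z
        where
        H⊆Z : (⟦ S ⟧ ∩ (b ∼_)) ⊆ (⟦ S ⟧ ∩ ⟦ Z ⟧)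
        H⊆Z = dim-full adj perp-hyperplane λ { x (Sx , Zx) → Sx , singular Z Zb Zx }
        swap⊆Z : ⟦ swap ⟧ ⊆ ⟦ Z ⟧
        swap⊆Z = cl-min (subspace Z) _ swap-clique (Zb ∷ All.map (λ {x} h → proj₂ (H⊆Z x h)) (members perp-hyperplane))

  -- Adding to L a point y of L^⊥ with y ≁ x, for some x in T, does not enlarge cl L ∩ T.
  abstract
    enlarge-avoiding : (T : Gen) → ∀ {L} → Ind L →
      Σ Gen λ U → cl L ⊆ ⟦ U ⟧ × (∀ z → ⟦ U ⟧ z → ⟦ T ⟧ z → cl L z)
    enlarge-avoiding T {L} iL = go n L iL (m≤n+m n (length L))
      where
      -- The fuel bounds how many points can still be added, an independent list having at most `n`.
      go : ∀ fuel L → Ind L → n ≤ length L + fuel →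
        Σ Gen λ U → cl L ⊆ ⟦ U ⟧ × (∀ z → ⟦ U ⟧ z → ⟦ T ⟧ z → cl L z)
      go fuel L iL bound with enlarge iL
      ... | U , L⊆U with find (proj₂ (meet U T)) (cl-subspace L) (cl? L (Ind⇒Clique L iL))
      ... | inj₁ sub = U , L⊆U , λ z Uz Tz → sub z (Uz , Tz)
      ... | inj₂ (x , (Ux , Tx) , x∉L) with separate L (Ind⇒Clique L iL) x (All.map (λ {a} c → singular U Ux (L⊆U a c)) (cl-self L))
      ... | inj₂ c = ⊥-elim (x∉L c)
      ... | inj₁ (y , yL , y≁x) = next fuel bound
        where
        xL : x ∼* L
        xL = All.map (λ {a} c → singular U Ux (L⊆U a c)) (cl-self L)
        iyL : Ind (y ∷ L)
        iyL = yL , (λ c → y≁x (∼-sym (c x xL))) , iL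
        next : ∀ fuel → n ≤ length L + fuel →
          Σ Gen λ U → cl L ⊆ ⟦ U ⟧ × (∀ z → ⟦ U ⟧ z → ⟦ T ⟧ z → cl L z)
        next zero b = ⊥-elim (n≮n n (≤-trans (s≤s (subst (n ≤_) (+-identityʳ _) b)) (ind-bound iyL)))
        next (suc fuel) b with go fuel (y ∷ L) iyL (subst (n ≤_) (+-suc _ _) b)
        ... | U' , yL⊆U' , avoid = U' , (λ z c → yL⊆U' z (cl-tail z c)) ,
          λ z Uz Tz → cl-hyperplane (Ind⇒Clique _ iyL) (∼-subspace x) (λ a c → c x xL)
            (λ x∼y → y≁x (∼-sym x∼y)) z (avoid z Uz Tz) (singular T Tx Tz)

  -- Intersections of generators and distance in the graph

  abstract
    -- For `y` in `S` outside `Z`, the neighbour `S` contains Z ∩ y^⊥. So Z ∩ T is inside `S` or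
    -- loses one dimension when cut with y^⊥.
    adjacent-cut : (S Z T : Gen) → Basis (⟦ Z ⟧ ∩ ⟦ S ⟧) (n ∸ 1) → ∀ {d} → Basis (⟦ Z ⟧ ∩ ⟦ T ⟧) d →
      (⟦ Z ⟧ ∩ ⟦ T ⟧) ⊆ ⟦ S ⟧ ⊎
      Σ ℕ λ j → d ≡ suc j × Σ (Pt → Set) λ X → Basis X j × X ⊆ (⟦ Z ⟧ ∩ (⟦ S ⟧ ∩ ⟦ T ⟧))
    adjacent-cut S Z T adj {d} B with extra (basisOf S) adj n∸1<n
    ... | y , Sy , y∉ = answer (hyperplane B y)
      where
      y∉Z : ¬ ⟦ Z ⟧ y
      y∉Z Zy = y∉ (Zy , Sy)
      into : ∀ {z} → ⟦ Z ⟧ z → y ∼ z → ⟦ S ⟧ z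
      into Zz y∼z = proj₁ (swap-unique Z y y∉Z S Sy adj) _ (swap-old Z y y∉Z Zz y∼z)
      answer : (⟦ Z ⟧ ∩ ⟦ T ⟧) ⊆ (y ∼_) ⊎ (Σ ℕ λ j → d ≡ suc j × Basis ((⟦ Z ⟧ ∩ ⟦ T ⟧) ∩ (y ∼_)) j) →
        (⟦ Z ⟧ ∩ ⟦ T ⟧) ⊆ ⟦ S ⟧ ⊎
        Σ ℕ λ j → d ≡ suc j × Σ (Pt → Set) λ X → Basis X j × X ⊆ (⟦ Z ⟧ ∩ (⟦ S ⟧ ∩ ⟦ T ⟧))
      answer (inj₁ ⊆y) = inj₁ λ { z (Zz , Tz) → into Zz (⊆y z (Zz , Tz)) }
      answer (inj₂ (j , e , C)) = inj₂ (j , e , ((⟦ Z ⟧ ∩ ⟦ T ⟧) ∩ (y ∼_)) , C ,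
        λ { z ((Zz , Tz) , y∼z) → Zz , into Zz y∼z , Tz })

  -- The hypotheses say that Z is a neighbour of S on a geodesic from S to T.
  abstract
    geodesic-∩ : (S Z T : Gen) → Basis (⟦ Z ⟧ ∩ ⟦ S ⟧) (n ∸ 1) → ∀ {m} →
      Basis (⟦ Z ⟧ ∩ ⟦ T ⟧) (suc m) → Basis (⟦ S ⟧ ∩ ⟦ T ⟧) m → (⟦ S ⟧ ∩ ⟦ T ⟧) ⊆ ⟦ Z ⟧
    geodesic-∩ S Z T adj BZ BS z Sz with adjacent-cut S Z T adj BZ
    ... | inj₁ sub = ⊥-elim (n≮n _ (dim-≤ BZ BS λ { x (Zx , Tx) → sub x (Zx , Tx) , Tx }))
    ... | inj₂ (_ , refl , X , BX , X⊆) = proj₁ (X⊆ z (dim-full BX BS (λ x Xx → proj₂ (X⊆ x Xx)) z Sz))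

  adjacent-≢ : (S T : Gen) → Basis (⟦ S ⟧ ∩ ⟦ T ⟧) (n ∸ 1) → ¬ (⟦ S ⟧ ⊆ ⟦ T ⟧)
  adjacent-≢ S T adj S⊆T = <⇒≱ n∸1<n (dim-≤ (basisOf S) adj λ x Sx → Sx , S⊆T x Sx)

  abstract
    -- If `a` were outside `U`, both `S` and `T` would be the unique neighbour of `U` through `a`.
    triangle-∩ : (S T U : Gen) → Basis (⟦ S ⟧ ∩ ⟦ T ⟧) (n ∸ 1) → Basis (⟦ U ⟧ ∩ ⟦ S ⟧) (n ∸ 1) →
      Basis (⟦ U ⟧ ∩ ⟦ T ⟧) (n ∸ 1) → (⟦ S ⟧ ∩ ⟦ T ⟧) ⊆ ⟦ U ⟧
    triangle-∩ S T U ST US UT a (Sa , Ta) with a ∈? U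
    ... | yes Ua = Ua
    ... | no a∉U = ⊥-elim (adjacent-≢ S T ST λ x Sx →
            proj₁ (swap-unique U a a∉U T Ta UT) x (proj₂ (swap-unique U a a∉U S Sa US) x Sx))

  abstract
    closer : (S T : Gen) → ∀ {d} → Basis (⟦ S ⟧ ∩ ⟦ T ⟧) d → d < n →
      Σ Gen λ Z → Basis (⟦ S ⟧ ∩ ⟦ Z ⟧) (n ∸ 1) × Basis (⟦ Z ⟧ ∩ ⟦ T ⟧) (suc d) × (⟦ S ⟧ ∩ ⟦ T ⟧) ⊆ ⟦ Z ⟧
    closer S T B d<n with extra (basisOf T) B d<n
    ... | b , Tb , b∉ = swap S b b∉S , swap-adj S b b∉S , swap-meet S b b∉S T Tb B ,
          λ { x (Sx , Tx) → swap-old S b b∉S Sx (singular T Tb Tx) }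
      where
      b∉S : ¬ ⟦ S ⟧ b
      b∉S Sb = b∉ (Sb , Tb)

  -- Each step raises the dimension of the intersection with `T` by at most one, and at the end it
  -- is `n`.
  walk-bound : ∀ j (S T : Gen) → Walk Π n S T j → ∀ {d} → Basis (⟦ S ⟧ ∩ ⟦ T ⟧) d → n ≤ d + j
  walk-bound zero S T (lift (S⊆T , _)) {d} B = subst (n ≤_) (sym (+-identityʳ d)) (dim-≤ (basisOf S) B λ x Sx → Sx , S⊆T x Sx)
  walk-bound (suc j) S T (Z , adj , w) {d} B with meet Z T
  ... | d' , B' = ≤-trans (walk-bound j Z T w B') (≤-trans (+-monoˡ-≤ j step) (≤-reflexive (sym (+-suc d j))))
    where
    ZS : Basis (⟦ Z ⟧ ∩ ⟦ S ⟧) (n ∸ 1)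
    ZS = ∩-swap (dim1⇒basis (basis-singsub (proj₂ (meet S Z))) adj)
    step : d' ≤ suc d
    step with adjacent-cut S Z T ZS B'
    ... | inj₁ sub = m≤n⇒m≤1+n (dim-≤ B' B λ { x (Zx , Tx) → sub x (Zx , Tx) , Tx })
    ... | inj₂ (_ , refl , X , BX , X⊆) = s≤s (dim-≤ BX B λ x Xx → proj₂ (X⊆ x Xx))

  walk : ∀ k (S T : Gen) → ∀ {d} → Basis (⟦ S ⟧ ∩ ⟦ T ⟧) d → d + k ≡ n → Walk Π n S T k
  walk zero S T {d} B e = lift (S⊆T , dim-full (basisOf S) (basisOf T) S⊆T)
    where
    S⊆T : ⟦ S ⟧ ⊆ ⟦ T ⟧
    S⊆T x Sx = proj₂ (dim-full (subst (Basis _) (trans (sym (+-identityʳ d)) e) B) (basisOf S) (λ _ → proj₁) x Sx)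
  walk (suc k) S T {d} B e with closer S T B (subst (d <_) e (m<m+n d (s≤s z≤n)))
  ... | Z , adj , B' , _ = Z , basis⇒dim1 adj , walk k Z T B' (trans (sym (+-suc d k)) e)

  dist : ∀ (S T : Gen) {d k} → Basis (⟦ S ⟧ ∩ ⟦ T ⟧) d → d + k ≡ n → Dist Π n S T k
  dist S T {d} {k} B e = walk k S T B e , λ j j<k w →
    <⇒≱ j<k (+-cancelˡ-≤ d k j (subst (_≤ d + j) (sym e) (walk-bound j S T w B)))

  dist-unique : ∀ (S T : Gen) {j k} → Dist Π n S T j → Dist Π n S T k → j ≡ k
  dist-unique S T {j} {k} (wj , minj) (wk , mink) with <-cmp j k
  ... | tri< j<k _ _ = ⊥-elim (mink j j<k wj)
  ... | tri≈ _ e _ = e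
  ... | tri> _ _ k<j = ⊥-elim (minj k k<j wk)

-- Dimensions of intersections under the embedding

module Embedding (Π Π' : PolarSpace) (n n' : ℕ) (rk : HasRank Π n) (rk' : HasRank Π' n') (n≤n' : n ≤ n')
  (f : 𝒢 Π n → 𝒢 Π' n') (iso : IsometricEmbedding Π n Π' n' f) where

  open Generators Π n rk
  module R' = Generators Π' n' rk'

  e : ℕ
  e = n' ∸ n

  F : Gen → R'.Pt → Set
  F S = R'.⟦ f S ⟧

  0<n : 0 < n
  0<n = ≤-trans (s≤s z≤n) n∸1<n

  abstract
    -- Distance is the codimension of the intersection in either space, so n - m is preserved and n'
    -- - (n - m) = e + m.
    f-dim : (S T : Gen) → ∀ {m} → Basis (⟦ S ⟧ ∩ ⟦ T ⟧) m → R'.Basis (F S ∩ F T) (e + m)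
    f-dim S T {m} B with R'.meet (f S) (f T)
    ... | d , B' = subst (R'.Basis (F S ∩ F T)) d≡ B'
      where
      m+k : m + (n ∸ m) ≡ n
      m+k = m+[n∸m]≡n (dim-≤ B (basisOf S) λ _ → proj₁)
      d+k : d + (n' ∸ d) ≡ n'
      d+k = m+[n∸m]≡n (R'.dim-≤ B' (R'.basisOf (f S)) λ _ → proj₁)
      k≡ : n' ∸ d ≡ n ∸ m
      k≡ = R'.dist-unique (f S) (f T) (R'.dist (f S) (f T) B' d+k)
             (proj₁ (iso S T (n ∸ m)) (dist S T B m+k))
      open ≡-Reasoning
      d≡ : d ≡ e + m
      d≡ = +-cancelʳ-≡ (n ∸ m) d (e + m) (begin
        d + (n ∸ m)        ≡⟨ cong (d +_) (sym k≡) ⟩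
        d + (n' ∸ d)       ≡⟨ d+k ⟩
        n'                 ≡⟨ sym (m∸n+n≡m n≤n') ⟩
        e + n              ≡⟨ cong (e +_) (sym m+k) ⟩
        e + (m + (n ∸ m))  ≡⟨ sym (+-assoc e m (n ∸ m)) ⟩
        (e + m) + (n ∸ m)  ∎)

    f-dim-suc : (S T : Gen) → ∀ {m} → Basis (⟦ S ⟧ ∩ ⟦ T ⟧) (suc m) → R'.Basis (F S ∩ F T) (suc (e + m))
    f-dim-suc S T {m} B = subst (R'.Basis (F S ∩ F T)) (+-suc e m) (f-dim S T B)

    f-adj : (S T : Gen) → Basis (⟦ S ⟧ ∩ ⟦ T ⟧) (n ∸ 1) → R'.Basis (F S ∩ F T) (n' ∸ 1)
    f-adj S T B = subst (R'.Basis (F S ∩ F T))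
      (trans (sym (+-∸-assoc e 0<n)) (cong (_∸ 1) (m∸n+n≡m n≤n'))) (f-dim S T B)

    f-mono : (S T : Gen) → Basis (⟦ S ⟧ ∩ ⟦ T ⟧) n → F S ⊆ F T
    f-mono S T B x Sx = proj₂ (R'.dim-full (subst (R'.Basis (F S ∩ F T)) (m∸n+n≡m n≤n') (f-dim S T B))
      (R'.basisOf (f S)) (λ _ → proj₁) x Sx)

    -- A basis of S ∩ T is completed by `C` to one of S ∩ Z. As `C` has at most n - 1 - k points, T
    -- ∩ C^⊥ has dimension greater than `k` and is not inside S ∩ T; its points are perpendicular to
    -- S ∩ T anyway.
    perp-point : (S T Z : Gen) → ∀ {k} → Basis (⟦ S ⟧ ∩ ⟦ T ⟧) k → Basis (⟦ S ⟧ ∩ ⟦ Z ⟧) (n ∸ 1) →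
      (⟦ S ⟧ ∩ ⟦ T ⟧) ⊆ ⟦ Z ⟧ →
      Σ Pt λ t → ⟦ T ⟧ t × ¬ ⟦ S ⟧ t × (∀ x → ⟦ S ⟧ x → ⟦ Z ⟧ x → t ∼ x)
    perp-point S T Z {k} B adj sub with extend (basis-singsub adj) (pts adj) (members adj) (pts B) (ind B)
      (All.map (λ { {x} (Sx , Tx) → Sx , sub x (Sx , Tx) }) (members B))
    ... | C , iC , HC , spans with hyperplanes C (basisOf T)
    ... | j , BT , n≤ with extra BT B k<j
      where
      open ≤-Reasoning
      k<j : k < j
      k<j = +-cancelʳ-≤ (length C) (suc k) j (begin
        suc k + length C            ≡⟨ cong suc (+-comm k (length C)) ⟩
        suc (length C + k)          ≡⟨ cong (λ i → suc (length C + i)) (sym (size B)) ⟩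
        suc (length C + length (pts B)) ≡⟨ cong suc (sym (length-++ C)) ⟩
        suc (length (C ++ pts B))   ≤⟨ s≤s (dim-≤ (basis-cl iC) adj (cl-min (basis-subspace adj) (C ++ pts B) (Ind⇒Clique _ iC)
                                        (++⁺ HC (All.map (λ { {x} (Sx , Tx) → Sx , sub x (Sx , Tx) }) (members B))))) ⟩
        suc (n ∸ 1)                 ≤⟨ n∸1<n ⟩
        n                           ≤⟨ n≤ ⟩
        j + length C                ∎)
    ... | t , (Tt , tC) , t∉ = t , Tt , (λ St → t∉ (St , Tt)) , λ x Sx Zx →
      cl-mono spans x (complete adj x (Sx , Zx)) t
        (++⁺ tC (All.map (λ { (_ , Ty) → singular T Tt Ty }) (members B)))

    -- Moving a pair of generators one step along a path

    Transfer : (S T Z : Gen) → Set₁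
    Transfer S T Z = Σ Gen λ T' →
      (⟦ Z ⟧ ∩ ⟦ T' ⟧) ⊆ (⟦ S ⟧ ∩ ⟦ T ⟧) × (F S ∩ F T) ⊆ (F Z ∩ F T')

    -- Y lies on a geodesic from S to T, and S, Y, Z have a common hyperplane.
    transfer-same : (S T Z : Gen) → ∀ {k} → Basis (⟦ S ⟧ ∩ ⟦ T ⟧) k → Basis (⟦ S ⟧ ∩ ⟦ Z ⟧) (n ∸ 1) →
      (⟦ S ⟧ ∩ ⟦ T ⟧) ⊆ ⟦ Z ⟧ → (⟦ Z ⟧ ∩ ⟦ T ⟧) ⊆ ⟦ S ⟧ → Transfer S T Z
    transfer-same S T Z B adj sub Z∩T⊆S with perp-point S T Z B adj sub
    ... | t , Tt , t∉S , t∼H = T , (λ { z (Zz , Tz) → Z∩T⊆S z (Zz , Tz) , Tz }) ,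
        λ { x (x∈S , x∈T) → S∩Y⊆Z x (x∈S , S∩T⊆Y x (x∈S , x∈T)) , x∈T }
      where
      t∉Z : ¬ ⟦ Z ⟧ t
      t∉Z Zt = t∉S (Z∩T⊆S t (Zt , Tt))
      Y : Gen
      Y = swap S t t∉S
      -- S ∩ Z and S ∩ t^⊥ coincide, the first being inside the second and of equal dimension.
      H⊆Z : ∀ x → ⟦ S ⟧ x → t ∼ x → ⟦ Z ⟧ x
      H⊆Z x Sx t∼x = proj₂ (dim-full adj (perp-hyperplane S t t∉S)
        (λ { y (Sy , Zy) → Sy , t∼H y Sy Zy }) x (Sx , t∼x))
      ZY : Basis (⟦ Z ⟧ ∩ ⟦ Y ⟧) (n ∸ 1)
      ZY = basis-cong ((λ { x (Sx , Zx) → Zx , swap-old S t t∉S Sx (t∼H x Sx Zx) }) ,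
                       (λ { x (Zx , Yx) → swap-cut S t t∉S (subspace Z) H⊆Z t∉Z Yx Zx , Zx })) adj
      S∩T⊆Y : (F S ∩ F T) ⊆ F Y
      S∩T⊆Y = R'.geodesic-∩ (f S) (f Y) (f T) (f-adj Y S (∩-swap (swap-adj S t t∉S)))
        (f-dim-suc Y T (swap-meet S t t∉S T Tt B)) (f-dim S T B)
      S∩Y⊆Z : (F S ∩ F Y) ⊆ F Z
      S∩Y⊆Z = R'.triangle-∩ (f S) (f Y) (f Z) (f-adj S Y (swap-adj S t t∉S))
        (f-adj Z S (∩-swap adj)) (f-adj Z Y ZY)

    -- Both Z and T' lie on geodesics from S to T.
    transfer-new : (S T Z : Gen) → ∀ {k} → Basis (⟦ S ⟧ ∩ ⟦ T ⟧) k → Basis (⟦ S ⟧ ∩ ⟦ Z ⟧) (n ∸ 1) →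
      (⟦ S ⟧ ∩ ⟦ T ⟧) ⊆ ⟦ Z ⟧ → (t : Pt) → ⟦ Z ⟧ t → ⟦ T ⟧ t → ¬ ⟦ S ⟧ t → Transfer S T Z
    transfer-new S T Z {k} B adj sub t Zt Tt t∉S with extra (basisOf S) adj n∸1<n
    ... | s , Ss , s∉ = T' , (λ { z (Zz , T'z) → inS z Zz T'z , inT z Zz T'z }) ,
        λ { x (x∈S , x∈T) → S∩T⊆Z x (x∈S , x∈T) , T∩S⊆T' x (x∈T , x∈S) }
      where
      s∉Z : ¬ ⟦ Z ⟧ s
      s∉Z Zs = s∉ (Ss , Zs)
      s∉T : ¬ ⟦ T ⟧ s
      s∉T Ts = s∉Z (sub s (Ss , Ts))
      T' : Gen
      T' = swap T s s∉T
      sw : ⟦ swap S t t∉S ⟧ ≐ ⟦ Z ⟧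
      sw = swap-unique S t t∉S Z Zt adj
      t≁s : t ≁ s
      t≁s t∼s = s∉Z (proj₁ sw s (swap-old S t t∉S Ss t∼s))
      ZT : Basis (⟦ Z ⟧ ∩ ⟦ T ⟧) (suc k)
      ZT = basis-cong ((λ { x (p , q) → proj₁ sw x p , q }) , (λ { x (p , q) → proj₂ sw x p , q }))
             (swap-meet S t t∉S T Tt B)
      S∩T⊆Z : (F S ∩ F T) ⊆ F Z
      S∩T⊆Z = R'.geodesic-∩ (f S) (f Z) (f T) (f-adj Z S (∩-swap adj)) (f-dim-suc Z T ZT) (f-dim S T B)
      T∩S⊆T' : (F T ∩ F S) ⊆ F T'
      T∩S⊆T' = R'.geodesic-∩ (f T) (f T') (f S) (f-adj T' T (∩-swap (swap-adj T s s∉T)))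
        (f-dim-suc T' S (swap-meet T s s∉T S Ss (∩-swap B))) (f-dim T S (∩-swap B))
      -- As `t` is in `T` and not perpendicular to `s`, the part of `T'` in t^⊥ lies in `T`; all of
      -- `Z` is in t^⊥.
      inT : ∀ z → ⟦ Z ⟧ z → ⟦ T' ⟧ z → ⟦ T ⟧ z
      inT z Zz T'z = swap-cut T s s∉T (∼-subspace t) (λ x Tx _ → singular T Tt Tx) t≁s T'z (singular Z Zt Zz)
      inS : ∀ z → ⟦ Z ⟧ z → ⟦ T' ⟧ z → ⟦ S ⟧ z
      inS z Zz T'z = swap-cut S t t∉S (∼-subspace s) (λ x Sx _ → singular S Ss Sx)
        (λ s∼t → t≁s (∼-sym s∼t)) (proj₂ sw z Zz) (singular T' (swap-new T s s∉T) T'z)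

    transfer : (S T Z : Gen) → Basis (⟦ S ⟧ ∩ ⟦ Z ⟧) (n ∸ 1) → (⟦ S ⟧ ∩ ⟦ T ⟧) ⊆ ⟦ Z ⟧ → Transfer S T Z
    transfer S T Z adj sub with find (proj₂ (meet Z T)) (subspace S) (_∈? S)
    ... | inj₁ Z∩T⊆S = transfer-same S T Z (proj₂ (meet S T)) adj sub Z∩T⊆S
    ... | inj₂ (t , (Zt , Tt) , t∉S) = transfer-new S T Z (proj₂ (meet S T)) adj sub t Zt Tt t∉S

    -- Induction on the distance from `S` to `X`. The new pair still meets inside `X`, and the point
    -- `x` is carried along until the first generator equals `X`. `Transfer` applies because S ∩ T ⊆
    -- S ∩ X ⊆ Z.
    f-∩-walk : ∀ j (S T X : Gen) → ∀ {d} → Basis (⟦ S ⟧ ∩ ⟦ X ⟧) d → d + j ≡ n →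
      (⟦ S ⟧ ∩ ⟦ T ⟧) ⊆ ⟦ X ⟧ → (F S ∩ F T) ⊆ F X
    f-∩-walk zero S T X {d} B eq sub x (x∈S , _) =
      f-mono S X (subst (Basis _) (trans (sym (+-identityʳ d)) eq) B) x x∈S
    f-∩-walk (suc j) S T X {d} B eq sub x x∈ with closer S X B (subst (d <_) eq (m<m+n d (s≤s z≤n)))
    ... | Z , adj , ZX , S∩X⊆Z with transfer S T Z adj (λ { y (Sy , Ty) → S∩X⊆Z y (Sy , sub y (Sy , Ty)) })
    ... | T' , back , forth = f-∩-walk j Z T' X ZX (trans (sym (+-suc d j)) eq) (λ y h → sub y (back y h)) x (forth x x∈)

    f-∩ : (S T X : Gen) → (⟦ S ⟧ ∩ ⟦ T ⟧) ⊆ ⟦ X ⟧ → (F S ∩ F T) ⊆ F X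
    f-∩ S T X with meet S X
    ... | d , B = f-∩-walk (n ∸ d) S T X B (m+[n∸m]≡n (dim-≤ B (basisOf S) λ _ → proj₁))

  -- The subspace `M` and the map `g`

  record Meeting (L : List Pt) : Set₁ where
    field
      left right : Gen
      in-left : cl L ⊆ ⟦ left ⟧
      in-right : cl L ⊆ ⟦ right ⟧
      exact : (⟦ left ⟧ ∩ ⟦ right ⟧) ⊆ cl L

  open Meeting

  abstract
    meeting : ∀ {L} → Ind L → Meeting L
    meeting iL with enlarge iL
    ... | S , L⊆S with enlarge-avoiding S iL
    ... | T , L⊆T , avoid = record { left = S ; right = T ; in-left = L⊆S ; in-right = L⊆T
                                   ; exact = λ { z (Sz , Tz) → avoid z Tz Sz } }

  -- Defined from one chosen pair of generators; `image-⊆` places it in the image of every generator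
  -- through `L`.
  image : ∀ {L} → Ind L → R'.Pt → Set
  image iL = F (left (meeting iL)) ∩ F (right (meeting iL))

  image-basis : ∀ {L} (iL : Ind L) → R'.Basis (image iL) (e + length L)
  image-basis iL = f-dim (left m) (right m) (basis-cong ((λ z c → in-left m z c , in-right m z c) , exact m) (basis-cl iL))
    where
    m : Meeting _
    m = meeting iL

  image-⊆ : ∀ {L} (iL : Ind L) (X : Gen) → All ⟦ X ⟧ L → image iL ⊆ F X
  image-⊆ {L} iL X h = f-∩ _ _ X λ z z∈ → cl-min (subspace X) L (Ind⇒Clique L iL) h z (exact (meeting iL) z z∈)

  M : R'.Pt → Set
  M = image {[]} tt

  M-basis : R'.Basis M e
  M-basis = subst (R'.Basis M) (+-identityʳ e) (image-basis {[]} tt)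

  M-⊆ : (X : Gen) → M ⊆ F X
  M-⊆ X = image-⊆ {[]} tt X []

  ind₁ : ∀ q → Ind (q ∷ [])
  ind₁ q = [] , cl-[] , tt

  cl₁ : ∀ {q z} → cl (q ∷ []) z → z ≡ q
  cl₁ {q} c = cl-min (point-subspace q) (q ∷ []) ([] , tt) (refl ∷ []) _ c

  G : Pt → R'.Pt → Set
  G q = image (ind₁ q)

  G-basis : ∀ q → R'.Basis (G q) (suc e)
  G-basis q = subst (R'.Basis (G q)) (+-comm e 1) (image-basis (ind₁ q))

  G-⊆ : ∀ {q} (X : Gen) → ⟦ X ⟧ q → G q ⊆ F X
  G-⊆ X Xq = image-⊆ (ind₁ _) X (Xq ∷ [])

  M⊆G : ∀ q → M ⊆ G q
  M⊆G q x Mx = M-⊆ _ x Mx , M-⊆ _ x Mx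

  g : Pt → Star Π' M (suc e)
  g q = G q , R'.basis-singsub (G-basis q) , R'.basis⇒dim1 (G-basis q) , M⊆G q

  -- Collinearity and frames under `g`

  abstract
    -- With `U` through `q` opposite `T`, the images of `U` and `T` meet in dimension `e`, too small
    -- for `G q`, which lies in `F U`.
    G-⊈ : ∀ q (T : Gen) → ¬ ⟦ T ⟧ q → Σ R'.Pt λ x → G q x × ¬ F T x
    G-⊈ q T q∉T with enlarge-avoiding T (ind₁ q)
    ... | U , q⊆U , avoid with R'.find (G-basis q) (R'.subspace (f T)) (R'._∈? (f T))
    ... | inj₂ x = x
    ... | inj₁ G⊆T = ⊥-elim (n≮n e (subst (suc e ≤_) (+-identityʳ e)
            (R'.dim-≤ (G-basis q) (f-dim U T opposite) λ x Gx → G-⊆ U (q⊆U q cl-head) x Gx , G⊆T x Gx)))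
      where
      opposite : Basis (⟦ U ⟧ ∩ ⟦ T ⟧) 0
      opposite = basis-cong ((λ _ c → ⊥-elim (cl-[] c)) ,
        (λ { z (Uz , Tz) → ⊥-elim (q∉T (subst ⟦ T ⟧ (cl₁ (avoid z Uz Tz)) Tz)) })) (basis-cl {[]} tt)

    G-collinear : ∀ {p q} → p ∼ q → StarColl Π' M (suc e) (g p) (g q)
    G-collinear {p} {q} p∼q with p ≟ q
    ... | yes refl = inj₁ (lift ((λ _ x → x) , (λ _ x → x)))
    ... | no p≢q = inj₂ ((image iL , R'.basis-singsub B , R'.basis⇒dim1 B , λ x Mx → M-⊆ _ x Mx , M-⊆ _ x Mx) ,
        (λ x Gx → G-⊆ _ (in-left m p (All.head self)) x Gx , G-⊆ _ (in-right m p (All.head self)) x Gx) ,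
        (λ x Gx → G-⊆ _ (in-left m q (All.head (All.tail self))) x Gx , G-⊆ _ (in-right m q (All.head (All.tail self))) x Gx))
      where
      iL : Ind (p ∷ q ∷ [])
      iL = (p∼q ∷ []) , (λ c → p≢q (cl₁ c)) , ind₁ q
      m : Meeting (p ∷ q ∷ [])
      m = meeting iL
      self : All (cl (p ∷ q ∷ [])) (p ∷ q ∷ [])
      self = cl-self (p ∷ q ∷ [])
      B : R'.Basis (image iL) (suc (suc e))
      B = subst (R'.Basis (image iL)) (+-comm e 2) (image-basis iL)

    G-perp : ∀ {p q} → StarColl Π' M (suc e) (g p) (g q) → ∀ {x y} → G p x → G q y → x R'.∼ y
    G-perp {q = q} (inj₁ (lift (p⊆q , _))) Gx Gy = proj₂ (R'.basis-singsub (G-basis q)) _ _ (p⊆q _ Gx) Gy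
    G-perp (inj₂ ((_ , (_ , sing) , _) , p⊆ , q⊆)) Gx Gy = sing _ _ (p⊆ _ Gx) (q⊆ _ Gy)

    -- Let `S` contain `p` and let `S'` be its neighbour through `q`. Points `x` of `G p` outside
    -- `F S'` and `y` of `G q` outside `F S` would be collinear; but `f S` is the neighbour of
    -- `f S'` through `x`, so it would contain `y`.
    G-reflects : ∀ {p q} → StarColl Π' M (suc e) (g p) (g q) → p ∼ q
    G-reflects {p} {q} col with p ∼? q
    ... | yes p∼q = p∼q
    ... | no p≁q = ⊥-elim contradict
      where
      S : Gen
      S = left (meeting (ind₁ p))
      Sp : ⟦ S ⟧ p
      Sp = in-left (meeting (ind₁ p)) p cl-head
      q∉S : ¬ ⟦ S ⟧ q
      q∉S Sq = p≁q (singular S Sp Sq)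
      S' : Gen
      S' = swap S q q∉S
      p∉S' : ¬ ⟦ S' ⟧ p
      p∉S' S'p = p≁q (singular S' S'p (swap-new S q q∉S))
      contradict : ⊥
      contradict with G-⊈ p S' p∉S' | G-⊈ q S q∉S
      ... | x , Gx , x∉ | y , Gy , y∉ = y∉ (proj₁ (R'.swap-unique (f S') x x∉ (f S) (G-⊆ S Sp x Gx)
              (f-adj S' S (∩-swap (swap-adj S q q∉S)))) y
              (R'.swap-old (f S') x x∉ (G-⊆ S' (swap-new S q q∉S) y Gy) (G-perp col Gx Gy)))

    g-frames : FramesPreserving Π n Π' M (suc e) g
    g-frames p (_ , partner) = injective , partner'
      where
      partner' : ∀ i → Σ (Fin (2 * n)) λ j → ¬ StarColl Π' M (suc e) (g (p i)) (g (p j)) ×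
        (∀ k → ¬ StarColl Π' M (suc e) (g (p i)) (g (p k)) → k ≡ j)
      partner' i with partner i
      ... | j , i≁j , only = j , (λ c → i≁j (G-reflects c)) , λ k ¬c → only k λ i∼k → ¬c (G-collinear i∼k)

      injective : ∀ i j → StarEq Π' M (suc e) (g (p i)) (g (p j)) → i ≡ j
      injective i j (lift (i⊆j , j⊆i)) with partner i
      ... | σ , i≁σ , _ with partner σ
      -- Both `i` and `j` equal the unique partner of `σ`.
      ... | τ , _ , only = trans (only i λ σ∼i → i≁σ (∼-sym σ∼i)) (sym (only j λ σ∼j → i≁σ (G-reflects (transport (G-collinear (∼-sym σ∼j))))))
        where
        transport : StarColl Π' M (suc e) (g (p j)) (g (p σ)) → StarColl Π' M (suc e) (g (p i)) (g (p σ))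
        transport (inj₁ (lift (a , b))) = inj₁ (lift ((λ x h → a x (i⊆j x h)) , (λ x h → j⊆i x (b x h))))
        transport (inj₂ (C , a , b)) = inj₂ (C , (λ x h → a x (i⊆j x h)) , b)

    -- Spanning of `f S` by the subspaces `g p`

    Covered : List Pt → R'.Pt → Set
    Covered L x = M x ⊎ Σ Pt λ p → cl L p × G p x

    covered-⊆ : ∀ {L} (X : Gen) → cl L ⊆ ⟦ X ⟧ → Covered L ⊆ F X
    covered-⊆ X L⊆X x (inj₁ Mx) = M-⊆ X x Mx
    covered-⊆ X L⊆X x (inj₂ (p , p∈ , Gx)) = G-⊆ X (L⊆X p p∈) x Gx

    -- The points found for `L` lie in `F U`, where `U` meets `S` exactly in `cl L`. Since `a` is
    -- outside `U`, some `x` in `G a` is outside `F U` and hence independent of them.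
    covered-basis : (S : Gen) → ∀ L → Ind L → cl L ⊆ ⟦ S ⟧ →
      Σ (List R'.Pt) λ D → R'.Ind D × length D ≡ e + length L × All (Covered L) D
    covered-basis S [] _ _ = R'.pts M-basis , R'.ind M-basis , trans (R'.size M-basis) (sym (+-identityʳ e)) ,
      All.map inj₁ (R'.members M-basis)
    covered-basis S (a ∷ L) (aL , a∉L , iL) aL⊆S with covered-basis S L iL (λ z c → aL⊆S z (cl-tail z c))
      | enlarge-avoiding S iL
    ... | D , iD , len , cov | U , L⊆U , avoid
      with G-⊈ a U (λ Ua → a∉L (avoid a Ua (aL⊆S a cl-head)))
    ... | x , Gx , x∉U = x ∷ D ,
        (All.map (λ {y} c → R'.singular (f S) (G-⊆ S (aL⊆S a cl-head) x Gx)
            (covered-⊆ S (λ z c' → aL⊆S z (cl-tail z c')) y c)) cov ,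
         (λ c → x∉U (R'.cl-min (R'.subspace (f U)) D (R'.Ind⇒Clique D iD) (All.map (λ {y} → covered-⊆ U L⊆U y) cov) x c)) ,
         iD) ,
        trans (cong suc len) (sym (+-suc e (length L))) ,
        inj₂ (a , cl-head , Gx) ∷
          All.map (λ { (inj₁ My) → inj₁ My ; (inj₂ (p , p∈ , Gy)) → inj₂ (p , cl-tail p p∈ , Gy) }) cov

    f-spanned : (S : Gen) → F S ≐ Span Π' (λ x → Σ Pt λ p → ⟦ S ⟧ p × proj₁ (g p) x)
    f-spanned S = spanned , λ x s → s (F S) (R'.subspace (f S)) λ { y (p , Sp , Gy) → G-⊆ S Sp y Gy }
      where
      BS : Basis ⟦ S ⟧ n
      BS = basisOf S
      spanned : F S ⊆ Span Π' (λ x → Σ Pt λ p → ⟦ S ⟧ p × proj₁ (g p) x)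
      -- The point `q` of `S` serves to place `M` inside some `G q`. The list `D` has `n'`
      -- independent points of `F S`, so it spans `F S`.
      spanned z z∈ Y Ys h with covered-basis S (pts BS) (ind BS) (sound BS) | extra BS (basis-cl {[]} tt) 0<n
      ... | D , iD , len , cov | q , Sq , _ = R'.cl-min Ys D (R'.Ind⇒Clique D iD) (All.map inY cov) z
              (R'.dim-full (subst (R'.Basis (R'.cl D)) lenD (R'.basis-cl iD)) (R'.basisOf (f S))
                (R'.cl-min (R'.subspace (f S)) D (R'.Ind⇒Clique D iD) (All.map (λ {y} → covered-⊆ S (sound BS) y) cov)) z z∈)
        where
        lenD : length D ≡ n'
        lenD = trans len (trans (cong (e +_) (size BS)) (m∸n+n≡m n≤n'))
        inY : ∀ {x} → Covered (pts BS) x → Y x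
        inY {x} (inj₁ Mx) = h x (q , Sq , M⊆G q x Mx)
        inY {x} (inj₂ (p , p∈ , Gx)) = h x (p , sound BS p p∈ , Gx)

theorem3 : (Π Π' : PolarSpace) (n n' : ℕ) → HasRank Π n → HasRank Π' n' → n ≤ n' →
    (f : 𝒢 Π n → 𝒢 Π' n') → IsometricEmbedding Π n Π' n' f →
    Σ (Point Π' → Set) λ M → SingSub Π' M × Dim1 Π' M (n' ∸ n)
    × ((S : 𝒢 Π n) → M ⊆ proj₁ (f S))
    × Σ (Point Π → Star Π' M (suc (n' ∸ n))) λ g →
    FramesPreserving Π n Π' M (suc (n' ∸ n)) g
    × ((S : 𝒢 Π n) →
    proj₁ (f S) ≐ Span Π' (λ x → Σ (Point Π) λ p → proj₁ S p × proj₁ (g p) x))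
theorem3 Π Π' n n' rk rk' n≤n' f iso =
  E.M , E.R'.basis-singsub E.M-basis , E.R'.basis⇒dim1 E.M-basis , E.M-⊆ , E.g , E.g-frames , E.f-spanned
  where module E = Embedding Π Π' n n' rk rk' n≤n' f iso
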